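{- Let $G$ be a connected bipartite graph with at least two vertices. A vertex $v\in V(G)$ is an $\mathcal{L}$-branch leaf of some BFS ordering of $G$ if and only if there is a vertex $r\in V(G)\setminus\{v\}$ such that $\mathrm{dist}_G(r,w)=\mathrm{dist}_{G-v}(r,w)$ for all $w\in V(G)\setminus\{v\}$.
   Context: Graphs are finite, simple, undirected; $\mathrm{dist}_H(a,b)$ is the number of edges of a shortest $a$-$b$ path in $H$. A vertex ordering of $G$ is a bijection $\sigma:\{1,\dots,n\}\to V(G)$; $u\prec_\sigma w$ means $u$ comes before $w$. BFS orderings are produced by the label search: initially all labels are $\emptyset$; for $i=1,\dots,n$ choose any unnumbered vertex $x$ such that there is no unnumbered $y$ with $\mathrm{label}(x)\prec\mathrm{label}(y)$, set $\sigma(i)=x$, and add $i$ to the labels of the unnumbered neighbors of $x$, where $A\prec B$ iff ($A=\emptyset$ and $B\neq\emptyset$) or $\min(A)>\min(B)$. The $\mathcal{L}$-tree of $\sigma$ is the spanning tree containing, for each $v\neq\sigma(1)$, the edge from $v$ to its rightmost neighbor $w$ with $w\prec_\sigma v$. A vertex $v\neq\sigma(1)$ that is a leaf of the $\mathcal{L}$-tree is an $\mathcal{L}$-branch leaf of $\sigma$. -}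

module Defs where

open import Data.Bool.Base using (Bool; if_then_else_; _∧_)
open import Data.Fin.Base using (Fin; toℕ; fromℕ<; _≤_; _<_)
open import Data.Fin.Permutation using (Permutation′; _⟨$⟩ʳ_; _⟨$⟩ˡ_)
open import Data.Fin.Properties using (_≤?_; _<?_; all?; toℕ≤n)
open import Data.Fin.Subset using (Subset; ⊥; ⁅_⁆; _∪_; _∈_; Nonempty; Empty)
open import Data.List.Base using (List; []; _∷_)
open import Data.List.Relation.Unary.Unique.Propositional using (Unique)
open import Data.Nat.Base as ℕ using (ℕ; zero; suc)
open import Data.Nat.Properties using (<⇒≤)
open import Data.Product using (Σ-syntax; ∃-syntax; ∃₂; ∃!; _×_; _,_; proj₁)
open import Data.Sum.Base using (_⊎_; [_,_]; swap)
open import Relation.Binary.Construct.Closure.ReflexiveTransitive using (Star; ε; _◅_)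
open import Relation.Binary.Definitions using (Decidable; Symmetric; Irreflexive)
open import Relation.Binary.PropositionalEquality using (_≡_; _≢_; refl; cong)
open import Relation.Nullary using (¬_; does)
open import Relation.Nullary.Decidable using (_×-dec_; _⊎-dec_; _→-dec_)

-- Finiteness is not a field: a finite graph is one whose vertex type is Fin n.
record Graph (V : Set) : Set₁ where
  field
    Adj        : V → V → Set
    adj?       : Decidable Adj
    adj-sym    : Symmetric Adj
    adj-irrefl : Irreflexive _≡_ Adj

open Graph public

module _ {V : Set} where

  edgeCount : ∀ {E : V → V → Set} {a b} → Star E a b → ℕ
  edgeCount ε       = zero
  edgeCount (_ ◅ p) = suc (edgeCount p)

  vertices : ∀ {E : V → V → Set} {a b} → Star E a b → List V
  vertices {a = a} ε       = a ∷ []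
  vertices {a = a} (_ ◅ p) = a ∷ vertices p

  record Path (G : Graph V) (a b : V) : Set where
    constructor path
    field
      walk   : Star (Adj G) a b
      simple : Unique (vertices walk)

  pathLength : ∀ {G : Graph V} {a b} → Path G a b → ℕ
  pathLength p = edgeCount (Path.walk p)

  -- "dist_G(a,b) = d"; it holds for no d when there is no path from a to b.
  Dist : Graph V → V → V → ℕ → Set
  Dist G a b d = (Σ[ p ∈ Path G a b ] pathLength p ≡ d)
               × (∀ (p : Path G a b) → d ℕ.≤ pathLength p)

  Connected : Graph V → Set
  Connected G = ∀ a b → Path G a b

  Bipartite : Graph V → Set
  Bipartite G = Σ[ side ∈ (V → Bool) ] (∀ {a b} → Adj G a b → side a ≢ side b)

  Leaf : Graph V → V → Set
  Leaf G a = ∃! _≡_ (Adj G a)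

infixl 6 _∖_ _-_

_∖_ : (V : Set) → V → Set
V ∖ v = Σ[ w ∈ V ] w ≢ v

_-_ : ∀ {V} → Graph V → (v : V) → Graph (V ∖ v)
(G - v) .Adj (a , _) (b , _)        = Adj G a b
(G - v) .adj? (a , _) (b , _)       = adj? G a b
(G - v) .adj-sym                    = adj-sym G
(G - v) .adj-irrefl eq              = adj-irrefl G (cong proj₁ eq)

-- Positions are 0, …, n-1 rather than 1, …, n.
Ordering : ℕ → Set
Ordering = Permutation′

module _ {n : ℕ} where

  pos : Ordering n → Fin n → Fin n
  pos σ v = σ ⟨$⟩ˡ v

  IsFirst : Ordering n → Fin n → Set
  IsFirst σ v = toℕ (pos σ v) ≡ 0

  IsMin : Subset n → Fin n → Set
  IsMin A a = a ∈ A × (∀ {b} → b ∈ A → a ≤ b)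

  infix 4 _≺_

  _≺_ : Subset n → Subset n → Set
  A ≺ B = (Empty A × Nonempty B)
        ⊎ ∃₂ λ a b → IsMin A a × IsMin B b × b < a

  module _ (G : Graph (Fin n)) (σ : Ordering n) where

    -- The labels after the first k vertices of σ have been numbered.  Step i
    -- chooses σ(i) and adds i to the labels of its neighbours that are still
    -- unnumbered, i.e. whose position is greater than i.
    label : ∀ k → k ℕ.≤ n → Fin n → Subset n
    label zero    _   x = ⊥
    label (suc k) k<n x =
      if does (i <? pos σ x) ∧ does (adj? G (σ ⟨$⟩ʳ i) x)
      then label k (<⇒≤ k<n) x ∪ ⁅ i ⁆
      else label k (<⇒≤ k<n) x
      where
      i : Fin n
      i = fromℕ< k<n

    -- The vertices unnumbered just before step i are those y with i ≤ pos σ y.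
    BFSOrdering : Set
    BFSOrdering = ∀ (i : Fin n) →
      ¬ (∃[ y ] i ≤ pos σ y × labelᵢ i (σ ⟨$⟩ʳ i) ≺ labelᵢ i y)
      where
      labelᵢ : Fin n → Fin n → Subset n
      labelᵢ i = label (toℕ i) (toℕ≤n i)

    -- w is the rightmost neighbour of v to the left of v.  There is no such w
    -- when v is the first vertex.
    Parent : Fin n → Fin n → Set
    Parent v w = (Adj G v w × pos σ w < pos σ v)
               × (∀ u → Adj G v u × pos σ u < pos σ v → pos σ u ≤ pos σ w)

    parent? : Decidable Parent
    parent? v w = (adj? G v w ×-dec (pos σ w <? pos σ v))
      ×-dec all? (λ u → (adj? G v u ×-dec (pos σ u <? pos σ v))
                        →-dec (pos σ u ≤? pos σ w))

    LTree : Graph (Fin n)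
    LTree .Adj v w    = Parent v w ⊎ Parent w v
    LTree .adj? v w   = parent? v w ⊎-dec parent? w v
    LTree .adj-sym    = swap
    LTree .adj-irrefl refl = [ irr , irr ]
      where
      irr : ∀ {v} → ¬ Parent v v
      irr ((v~v , _) , _) = adj-irrefl G refl v~v

    LBranchLeaf : Fin n → Set
    LBranchLeaf v = ¬ IsFirst σ v × Leaf LTree v

-- In a BFS ordering σ from r the distance levels occur in order, and in a bipartite graph
-- adjacent vertices lie on consecutive levels, so parents lie exactly one level below their
-- children.  If v is an L-branch leaf it is nobody's parent, and following parents from w ≠ v
-- gives a shortest path to r that avoids v.
--
-- Conversely, let deletion of v preserve distances from r.  Take a BFS ordering from r that breaks
-- ties in favour of a fixed geodesic from r to v, so that v is the first vertex of its level.  A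
-- child of v would have another neighbour on the level of v, which comes after v and hence
-- contradicts v being the rightmost earlier neighbour.  The ordering sorts vertices by the least
-- key satisfying key w = tie w + N (1 + min over neighbours u of key u): read in base N, the keys
-- compare first by distance and then lexicographically along paths from r.
module Submission where

open import Defs
open import Data.Bool.Base using (Bool; not; if_then_else_; _∧_)
open import Data.Bool.Properties using (¬-not)
open import Data.Fin.Base as Fin using (Fin; toℕ; fromℕ<; punchOut)
open import Data.Fin.Permutation using (permutation; _⟨$⟩ʳ_; inverseʳ; inverseˡ)
open import Data.Fin.Properties as Fin using (_≟_; any?; toℕ-injective; toℕ-fromℕ<; toℕ<n; toℕ≤n)
open import Data.Fin.Subset using (Subset; _∈_; _∪_; ⁅_⁆; ∣_∣; Nonempty)
open import Data.Fin.Subset.Properties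
  using (_∈?_; nonempty?; ∉⊥; ∈⊤; p⊂q⇒∣p∣<∣q∣; ∣⊤∣≡n; x∈p∪q⁺; x∈p∪q⁻; x∈⁅x⁆; x∈⁅y⁆⇒x≡y)
open import Data.List.Base using (List; []; _∷_; allFin; filter)
import Data.List.Extrema
open import Data.List.Membership.Propositional.Properties using (∈-allFin; ∈-filter⁺)
import Data.List.Membership.DecPropositional
open import Data.List.Membership.Propositional using () renaming (_∈_ to _∈ₗ_)
open import Data.List.Relation.Unary.All as All using (All; []; _∷_)
open import Data.List.Relation.Unary.All.Properties using (all-filter)
open import Data.List.Relation.Unary.AllPairs as AllPairs using (AllPairs; []; _∷_)
open import Data.List.Relation.Unary.Any using (here; there)
open import Data.Nat.Base using (ℕ; zero; suc; _+_; _*_; _≤_; _<_; z≤n; s≤s; s≤s⁻¹)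
open import Data.Nat.Properties as ℕ
  using (≤-refl; ≤-reflexive; ≤-trans; ≤-antisym; <-irrefl; <-trans; ≤-<-trans; <-≤-trans; <⇒≤; <⇒≱; ≮⇒≥; ≰⇒>)
open import Data.Nat.Induction using (<-rec)
open import Data.Product using (Σ-syntax; ∃; ∃-syntax; _×_; _,_; proj₁; proj₂)
open import Data.Sum.Base using (_⊎_; inj₁; inj₂; [_,_])
open import Data.Vec.Base using (tabulate)
open import Data.Vec.Properties using (lookup∘tabulate; lookup⇒[]=; []=⇒lookup)
open import Function.Base using (_∘_; id; _on_)
open import Function.Bundles using (_⇔_; mk⇔; Equivalence)
open import Function.Definitions using (Injective)
open import Level using (0ℓ)
open import Relation.Binary.Bundles using (TotalOrder)
open import Relation.Binary.Construct.Closure.ReflexiveTransitive as Star using (Star; ε; _◅_; _◅◅_)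
open import Relation.Binary.Construct.Flip.EqAndOrd as Flip using ()
open import Relation.Binary.Definitions using (tri<; tri≈; tri>)
open import Relation.Binary.PropositionalEquality
  using (_≡_; _≢_; refl; sym; trans; cong; subst; subst₂)
open import Relation.Nullary using (¬_; Dec; yes; no; does; contradiction)
open import Relation.Nullary.Decidable using (_×-dec_; _⊎-dec_; map′; dec-true)
open import Relation.Unary using (Decidable)

open Equivalence using (to; from)

-- Extremal elements

module _ (O : TotalOrder 0ℓ 0ℓ 0ℓ) where
  private module O = TotalOrder O
  open Data.List.Extrema O using (argmax; argmax-all; f[xs]≤f[argmax])

  -- The order is a parameter because parents are maxima of `pos`, while minima of labels are maxima
  -- for the reversed order.
  maximiser : ∀ {n} {P : Fin n → Set} → Decidable P → (f : Fin n → O.Carrier) → ∃ P →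
              ∃[ x ] (P x × ∀ y → P y → f y O.≤ f x)
  maximiser {n} P? f (x₀ , px₀) =
    argmax f x₀ xs , argmax-all f px₀ (all-filter P? (allFin n)) ,
    λ y py → All.lookup (f[xs]≤f[argmax] {f = f} x₀ xs) (∈-filter⁺ P? (∈-allFin y) py)
    where
    xs : List (Fin n)
    xs = filter P? (allFin n)

least : ∀ {P : ℕ → Set} → Decidable P → ∀ {k} → P k → ∃[ m ] (P m × ∀ {j} → P j → m ≤ j)
least {P} P? {k} pk with P? 0
... | yes p0 = 0 , p0 , λ _ → z≤n
... | no ¬p0 with k
...   | zero   = contradiction pk ¬p0
...   | suc k′ with least {P ∘ suc} (P? ∘ suc) pk
...     | m , pm , m≤ = suc m , pm , λ { {zero} p0 → contradiction p0 ¬p0 ; {suc j} pj → s≤s (m≤ pj) }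

-- Walks

Rise : ∀ {V : Set} → (V → V → Set) → (V → ℕ) → V → V → Set
Rise E ℓ a b = E a b × ℓ b ≡ suc (ℓ a)

module _ {V : Set} {E : V → V → Set} {ℓ : V → ℕ} where

  rising-length : ∀ {a b} (q : Star (Rise E ℓ) a b) → ℓ a + edgeCount (Star.map {U = E} proj₁ q) ≡ ℓ b
  rising-length ε = ℕ.+-identityʳ _
  rising-length {a} ((_ , up) ◅ q) =
    trans (ℕ.+-suc (ℓ a) _)
      (trans (cong (_+ edgeCount (Star.map {U = E} proj₁ q)) (sym up)) (rising-length q))

  rising-above : ∀ {a b} (q : Star (Rise E ℓ) a b) →
                 All (λ x → ℓ a ≤ ℓ x) (vertices (Star.map {U = E} proj₁ q))
  rising-above ε = ≤-refl ∷ []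
  rising-above ((_ , up) ◅ q) =
    ≤-refl ∷ All.map (≤-trans (≤-trans (ℕ.n≤1+n _) (≤-reflexive (sym up)))) (rising-above q)

  rising-ascending : ∀ {a b} (q : Star (Rise E ℓ) a b) →
                     AllPairs (_<_ on ℓ) (vertices (Star.map {U = E} proj₁ q))
  rising-ascending ε = [] ∷ []
  rising-ascending ((_ , up) ◅ q) =
    All.map (≤-trans (≤-reflexive (sym up))) (rising-above q) ∷ rising-ascending q

  lipschitz-walk : (∀ {a b} → E a b → ℓ b ≤ suc (ℓ a)) →
                   ∀ {a b} (p : Star E a b) → ℓ b ≤ ℓ a + edgeCount p
  lipschitz-walk lip ε = ℕ.m≤m+n _ _
  lipschitz-walk lip {a} (e ◅ p) = ≤-trans (lipschitz-walk lip p)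
    (≤-trans (ℕ.+-monoˡ-≤ (edgeCount p) (lip e)) (≤-reflexive (sym (ℕ.+-suc (ℓ a) _))))

  -- No edge raises `ℓ` by more than one, so a walk no longer than its total gain gains exactly one
  -- on every edge, in particular on the last.
  steep-walk-last : (∀ {a b} → E a b → ℓ b ≤ suc (ℓ a)) →
                    ∀ {a b} (p : Star E a b) → ℓ a + edgeCount p ≤ ℓ b → a ≢ b →
                    ∃[ u ] Rise E ℓ u b
  steep-walk-last lip ε steep a≢b = contradiction refl a≢b
  steep-walk-last lip {a} (e ◅ ε) steep a≢b =
    a , e , ≤-antisym (lip e) (≤-trans (≤-reflexive (ℕ.+-comm 1 (ℓ a))) steep)
  steep-walk-last lip {a} {b} (_◅_ {j = c} e p@(_ ◅ p′)) steep a≢b =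
    -- The remaining walk `p` has an edge, so it cannot fit a gain of zero.
    steep-walk-last lip p steep′ λ { refl → ℕ.m+1+n≰m (ℓ c) steep′ }
    where
    steep′ : ℓ c + edgeCount p ≤ ℓ b
    steep′ = ≤-trans (ℕ.+-monoˡ-≤ (edgeCount p) (lip e))
               (≤-trans (≤-reflexive (sym (ℕ.+-suc (ℓ a) _))) steep)

module _ {V : Set} {G : Graph V} where

  -- `ℓ` increases strictly along the rising walk, which is therefore simple; `lipschitz-walk`
  -- bounds the length of every path from below.
  rising-dist : ∀ {ℓ : V → ℕ} {r w} → (∀ {a b} → Adj G a b → ℓ b ≤ suc (ℓ a)) → ℓ r ≡ 0 →
                Star (Rise (Adj G) ℓ) r w → Dist G r w (ℓ w)
  rising-dist {ℓ} {r} {w} lip ℓr≡0 q =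
    (path (Star.map proj₁ q) (AllPairs.map (λ lt eq → <-irrefl (cong ℓ eq) lt) (rising-ascending q))
      , subst (λ a → a + edgeCount (Star.map {U = Adj G} proj₁ q) ≡ ℓ w) ℓr≡0 (rising-length q)) ,
    λ p → subst (λ a → ℓ w ≤ a + pathLength p) ℓr≡0 (lipschitz-walk lip (Path.walk p))

  dist-unique : ∀ {a b d e} → Dist G a b d → Dist G a b e → d ≡ e
  dist-unique ((p , refl) , p-min) ((q , refl) , q-min) = ≤-antisym (p-min q) (q-min p)

-- Minimum-cost potentials

module _ {n : ℕ} (G : Graph (Fin n)) (r : Fin n) (g : Fin n → ℕ → ℕ) where

  -- The Bellman equations for cheapest walks from `r`, where `g w m` is the cost of extending a
  -- walk of cost `m` to `w`. Taking `suc` gives distances; taking `append` gives sorting keys.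
  record Potential : Set where
    field
      cost      : Fin n → ℕ
      cost-root : cost r ≡ 0
      cost-step : ∀ {u w} → Adj G u w → cost w ≤ g w (cost u)
      cost-pred : ∀ {w} → w ≢ r → ∃[ u ] (Adj G u w × cost w ≡ g w (cost u))

  data WalkCost : Fin n → ℕ → Set where
    start : WalkCost r 0
    step  : ∀ {u w m c} → Adj G u w → WalkCost u m → c ≡ g w m → WalkCost w c

  -- A last step comes from a strictly smaller cost, so well-founded recursion on the cost leaves
  -- only a finite search over `u` and `m`.
  walkCost? : (∀ {w m} → m < g w m) → ∀ c w → Dec (WalkCost w c)
  walkCost? g-inc = <-rec (λ c → ∀ w → Dec (WalkCost w c)) λ c rec w →
    map′ build split
      ((w ≟ r ×-dec c ℕ.≟ 0) ⊎-dec
       any? λ u → any? λ (m : Fin c) →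
         (adj? G u w ×-dec rec (toℕ<n m) u) ×-dec (c ℕ.≟ g w (toℕ m)))
    where
    Split : Fin n → ℕ → Set
    Split w c = (w ≡ r × c ≡ 0) ⊎
      ∃[ u ] ∃[ m ] ((Adj G u w × WalkCost u (toℕ {c} m)) × c ≡ g w (toℕ m))
    build : ∀ {w c} → Split w c → WalkCost w c
    build (inj₁ (refl , refl)) = start
    build (inj₂ (u , m , (e , k) , eq)) = step e k eq
    split : ∀ {w c} → WalkCost w c → Split w c
    split start = inj₁ (refl , refl)
    split {w} {c} (step {u} {m = m} e k refl) =
      inj₂ (u , fromℕ< g-inc , (e , subst (WalkCost u) (sym (toℕ-fromℕ< g-inc)) k)
               , cong (g w) (sym (toℕ-fromℕ< g-inc)))

  walkCost-exists : ∀ {a b c} → WalkCost a c → Star (Adj G) a b → ∃ (WalkCost b)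
  walkCost-exists k ε       = _ , k
  walkCost-exists k (e ◅ p) = walkCost-exists (step e k refl) p

  -- Otherwise unification and with-abstraction unfold the search.
  abstract
    potential : Connected G → (∀ {w m} → m < g w m) → (∀ {w m m′} → m ≤ m′ → g w m ≤ g w m′) →
                Potential
    potential conn g-inc g-mono = record
      { cost      = cost
      ; cost-root = ℕ.n≤0⇒n≡0 (minimal start)
      ; cost-step = λ e → minimal (step e (attained _) refl)
      ; cost-pred = pred
      }
      where
      best : ∀ w → ∃[ m ] (WalkCost w m × ∀ {j} → WalkCost w j → m ≤ j)
      best w = least (λ c → walkCost? g-inc c w) (proj₂ (walkCost-exists start (Path.walk (conn r w))))
      cost : Fin n → ℕ
      cost w = proj₁ (best w)
      attained : ∀ w → WalkCost w (cost w)
      attained w = proj₁ (proj₂ (best w))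
      minimal : ∀ {w j} → WalkCost w j → cost w ≤ j
      minimal {w} = proj₂ (proj₂ (best w))
      -- By monotonicity the part of the walk before its last edge may be replaced by a cheapest
      -- one.
      last-step : ∀ {w c} → w ≢ r → WalkCost w c → ∃[ u ] (Adj G u w × g w (cost u) ≤ c)
      last-step w≢r start           = contradiction refl w≢r
      last-step w≢r (step e k refl) = _ , e , g-mono (minimal k)
      pred : ∀ {w} → w ≢ r → ∃[ u ] (Adj G u w × cost w ≡ g w (cost u))
      pred {w} w≢r with last-step w≢r (attained w)
      ... | u , e , le = u , e , ≤-antisym (minimal (step e (attained u) refl)) le

-- Distance levels

module Levels {n : ℕ} (G : Graph (Fin n)) (conn : Connected G) (r : Fin n) where

  open Potential (potential G r (λ _ → suc) conn ≤-refl s≤s) public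
    renaming (cost to level; cost-root to level-root; cost-step to level-step; cost-pred to level-pred)

  level≡0 : ∀ {w} → level w ≡ 0 → w ≡ r
  level≡0 {w} eq with w ≟ r
  ... | yes w≡r = w≡r
  ... | no  w≢r with level-pred w≢r
  ...   | u , _ , up with trans (sym eq) up
  ...     | ()

  module _ (bip : Bipartite G) where

    private
      side : Fin n → Bool
      side = proj₁ bip

      opposite : ∀ {a b} → Adj G a b → side a ≡ not (side b)
      opposite e = ¬-not (proj₂ bip e)

    -- Predecessors of `a` and `b` share a side by induction on `k`, and each edge to them flips it.
    level-side : ∀ k {a b} → level a ≡ k → level b ≡ k → side a ≡ side b
    level-side zero    ℓa ℓb = cong side (trans (level≡0 ℓa) (sym (level≡0 ℓb)))
    level-side (suc k) {a} {b} ℓa ℓb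
      with level-pred {a} (λ { refl → ℕ.1+n≢0 (trans (sym ℓa) level-root) })
         | level-pred {b} (λ { refl → ℕ.1+n≢0 (trans (sym ℓb) level-root) })
    ... | a′ , ea , ua | b′ , eb , ub =
      trans (opposite (adj-sym G ea))
        (trans (cong not (level-side k (ℕ.suc-injective (trans (sym ua) ℓa))
                                        (ℕ.suc-injective (trans (sym ub) ℓb))))
               (sym (opposite (adj-sym G eb))))

    level-adj : ∀ {a b} → Adj G a b → level a ≤ level b → level b ≡ suc (level a)
    level-adj {a} {b} e a≤b = ≤-antisym (level-step e)
      (ℕ.≤∧≢⇒< a≤b λ eq → proj₂ bip e (level-side (level b) eq refl))

  -- W stands for V(G) or, through the inclusion ι, for V(G − v).
  descend : ∀ {W : Set} (E : W → W → Set) (ι : W → Fin n) (s : W) → (∀ {w} → ι w ≡ r → w ≡ s) →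
            (∀ w → ι w ≢ r → ∃[ u ] Rise E (level ∘ ι) u w) →
            ∀ w → Star (Rise E (level ∘ ι)) s w
  descend {W} E ι s at-root down w = go (level (ι w)) w refl
    where
    go : ∀ k w → level (ι w) ≡ k → Star (Rise E (level ∘ ι)) s w
    go zero    w eq = subst (Star (Rise E (level ∘ ι)) s) (sym (at-root (level≡0 eq))) ε
    go (suc k) w eq with down w (λ w≡r → ℕ.1+n≢0 (trans (sym eq) (trans (cong level w≡r) level-root)))
    ... | u , e , up = go k u (ℕ.suc-injective (trans (sym up) eq)) ◅◅ ((e , up) ◅ ε)

  geodesic : ∀ w → Star (Rise (Adj G) level) r w
  geodesic = descend (Adj G) id r id (λ _ → level-pred)

-- BFS orderings

module _ {n : ℕ} (σ : Ordering n) where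

  pos-injective : ∀ {x y} → pos σ x ≡ pos σ y → x ≡ y
  pos-injective eq = trans (sym (inverseʳ σ)) (trans (cong (σ ⟨$⟩ʳ_) eq) (inverseʳ σ))

module _ {n : ℕ} (G : Graph (Fin n)) (σ : Ordering n) where

  -- The BFS rule without labels.
  EarlierHasEarlierNeighbour : Set
  EarlierHasEarlierNeighbour = ∀ {x y z} → pos σ x Fin.< pos σ y → Adj G z y → pos σ z Fin.< pos σ x →
                               ∃[ u ] (Adj G u x × pos σ u Fin.≤ pos σ z)

  private
    -- The two decisions are variables here, so that matching on them evaluates the `if` in `label`.
    ∈-if-∪⇔ : ∀ {P Q : Set} (P? : Dec P) (Q? : Dec Q) {A : Subset n} {i j : Fin n} →
              j ∈ (if does P? ∧ does Q? then A ∪ ⁅ i ⁆ else A) ⇔ (j ∈ A ⊎ (P × Q × j ≡ i))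
    ∈-if-∪⇔ (yes p) (yes q) {A} {i} = mk⇔
      (λ j∈ → [ inj₁ , (λ j∈i → inj₂ (p , q , x∈⁅y⁆⇒x≡y i j∈i)) ] (x∈p∪q⁻ A ⁅ i ⁆ j∈))
      (λ { (inj₁ j∈A) → x∈p∪q⁺ (inj₁ j∈A) ; (inj₂ (_ , _ , refl)) → x∈p∪q⁺ (inj₂ (x∈⁅x⁆ i)) })
    ∈-if-∪⇔ (yes p) (no ¬q) = mk⇔ inj₁ λ { (inj₁ j∈A) → j∈A ; (inj₂ (_ , q , _)) → contradiction q ¬q }
    ∈-if-∪⇔ (no ¬p) _       = mk⇔ inj₁ λ { (inj₁ j∈A) → j∈A ; (inj₂ (p , _)) → contradiction p ¬p }

  ∈-label⁻ : ∀ k (k≤n : k ≤ n) {x j} → j ∈ label G σ k k≤n x →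
             toℕ j < k × j Fin.< pos σ x × Adj G (σ ⟨$⟩ʳ j) x
  ∈-label⁻ zero    _   j∈ = contradiction j∈ ∉⊥
  ∈-label⁻ (suc k) k<n {x} j∈
    with to (∈-if-∪⇔ (fromℕ< k<n Fin.<? pos σ x) (adj? G (σ ⟨$⟩ʳ fromℕ< k<n) x)) j∈
  ... | inj₁ j∈A with ∈-label⁻ k (<⇒≤ k<n) j∈A
  ...   | j<k , rest = ℕ.m<n⇒m<1+n j<k , rest
  ∈-label⁻ (suc k) k<n j∈ | inj₂ (i<x , e , refl) =
    s≤s (≤-reflexive (toℕ-fromℕ< k<n)) , i<x , e

  ∈-label⁺ : ∀ k (k≤n : k ≤ n) {x j} → toℕ j < k → j Fin.< pos σ x → Adj G (σ ⟨$⟩ʳ j) x →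
             j ∈ label G σ k k≤n x
  ∈-label⁺ (suc k) k<n {x} {j} j<1+k j<x e =
    from (∈-if-∪⇔ (fromℕ< k<n Fin.<? pos σ x) (adj? G (σ ⟨$⟩ʳ fromℕ< k<n) x)) cases
    where
    cases : _ ⊎ _
    cases with toℕ j ℕ.<? k
    ... | yes j<k = inj₁ (∈-label⁺ k (<⇒≤ k<n) j<k j<x e)
    ... | no  j≮k with toℕ-injective (trans (≤-antisym (s≤s⁻¹ j<1+k) (≮⇒≥ j≮k)) (sym (toℕ-fromℕ< k<n)))
    ...   | refl = inj₂ (j<x , e , refl)

  -- If all neighbours of `x` came after `z`, then the label of `x` would be empty or have its
  -- minimum beyond the position of `z`, which belongs to the label of `y`; the search could not
  -- have chosen `x`.
  bfs⇒earlier : BFSOrdering G σ → EarlierHasEarlierNeighbour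
  bfs⇒earlier bfs {x} {y} {z} x<y zy z<x
    with any? (λ u → adj? G u x ×-dec (pos σ u Fin.≤? pos σ z))
  ... | yes found = found
  ... | no  none  = contradiction (y , <⇒≤ x<y , label-≺) (bfs i)
    where
    i : Fin n
    i = pos σ x
    L : Fin n → Subset n
    L = label G σ (toℕ i) (toℕ≤n i)
    minimum : ∀ {A : Subset n} → Nonempty A → ∃ (IsMin A)
    minimum {A} ne with maximiser (Flip.totalOrder (Fin.≤-totalOrder n)) (_∈? A) id ne
    ... | a , a∈A , a≤ = a , a∈A , λ {b} → a≤ b
    z∈Ly : pos σ z ∈ L y
    z∈Ly = ∈-label⁺ (toℕ i) (toℕ≤n i) z<x (<-trans z<x x<y) (subst (λ t → Adj G t y) (sym (inverseʳ σ)) zy)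
    label-≺ : L (σ ⟨$⟩ʳ i) ≺ L y
    label-≺ rewrite inverseʳ σ {x} with nonempty? (L x)
    ... | no  Lx-empty = inj₁ (Lx-empty , _ , z∈Ly)
    ... | yes Lx-ne with minimum Lx-ne | minimum (_ , z∈Ly)
    ...   | a , a-min | b , b-min = inj₂ (a , b , a-min , b-min , ≰⇒> λ a≤b →
      none (σ ⟨$⟩ʳ a , proj₂ (proj₂ (∈-label⁻ (toℕ i) (toℕ≤n i) (proj₁ a-min))) ,
        subst (Fin._≤ pos σ z) (sym (inverseˡ σ)) (≤-trans a≤b (proj₂ b-min z∈Ly))))

  -- Each entry of the label of `y` is matched by an entry of the label of `x` that is no larger,
  -- which rules out both forms of `≺`.
  earlier⇒bfs : EarlierHasEarlierNeighbour → BFSOrdering G σ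
  earlier⇒bfs earlier i (y , i≤y , lt) = refute lt
    where
    L : Fin n → Subset n
    L = label G σ (toℕ i) (toℕ≤n i)
    x : Fin n
    x = σ ⟨$⟩ʳ i
    pos-x : pos σ x ≡ i
    pos-x = inverseˡ σ
    witness : ∀ {b} → b ∈ L y → ∃[ a ] (a ∈ L x × a Fin.≤ b)
    witness {b} b∈ with ∈-label⁻ (toℕ i) (toℕ≤n i) b∈ | x ≟ y
    ... | _ | yes refl = b , b∈ , ≤-refl
    ... | b<i , b<y , e | no x≢y with earlier {x} {y} {σ ⟨$⟩ʳ b} x<y e b<x
      where
      x<y : pos σ x Fin.< pos σ y
      x<y = Fin.≤∧≢⇒< (subst (Fin._≤ pos σ y) (sym pos-x) i≤y) (x≢y ∘ pos-injective σ)
      b<x : pos σ (σ ⟨$⟩ʳ b) Fin.< pos σ x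
      b<x = subst₂ Fin._<_ (sym (inverseˡ σ)) (sym pos-x) b<i
    ...   | u , ux , u≤b = pos σ u ,
      ∈-label⁺ (toℕ i) (toℕ≤n i) u<i (subst (pos σ u Fin.<_) (sym pos-x) u<i)
        (subst (λ t → Adj G t x) (sym (inverseʳ σ)) ux) ,
      u≤b′
      where
      u≤b′ : pos σ u Fin.≤ b
      u≤b′ = subst (pos σ u Fin.≤_) (inverseˡ σ) u≤b
      u<i : toℕ (pos σ u) < toℕ i
      u<i = ≤-<-trans u≤b′ b<i
    refute : ¬ (L x ≺ L y)
    refute (inj₁ (Lx-empty , b , b∈)) with witness b∈
    ... | a , a∈ , _ = Lx-empty (a , a∈)
    refute (inj₂ (a , b , a-min , b-min , b<a)) with witness (proj₁ b-min)
    ... | a′ , a′∈ , a′≤b = <⇒≱ b<a (≤-trans (proj₂ a-min a′∈) a′≤b)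

  parent-unique : ∀ {w u u′} → Parent G σ w u → Parent G σ w u′ → u ≡ u′
  parent-unique (u-left , u-max) (u′-left , u′-max) =
    pos-injective σ (Fin.≤-antisym (u′-max _ u-left) (u-max _ u′-left))

  module _ (conn : Connected G) {r : Fin n} (r-first : ∀ x → pos σ r Fin.≤ pos σ x)
           (earlier : EarlierHasEarlierNeighbour) where

    open Levels G conn r

    -- Induction on the level of `y`, with a predecessor `z` of `y` one level down. Either `x` is no
    -- later than `z`, or the BFS rule gives `x` a neighbour no later than `z`; the induction
    -- hypothesis bounds the level of `x` or of that neighbour.
    level-mono : ∀ {x y} → pos σ x Fin.< pos σ y → level x ≤ level y
    level-mono x<y = go _ refl x<y
      where
      go : ∀ k {x y} → level y ≡ k → pos σ x Fin.< pos σ y → level x ≤ level y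
      go zero    {x} {y} ℓy x<y =
        contradiction (r-first x) (<⇒≱ (subst (λ t → pos σ x Fin.< pos σ t) (level≡0 ℓy) x<y))
      go (suc k) {x} {y} ℓy x<y with level-pred {y} (λ { refl → ℕ.1+n≢0 (trans (sym ℓy) level-root) })
      ... | z , zy , up = ≤-trans below (≤-reflexive (sym up))
        where
        IH : ∀ {t} → pos σ t Fin.≤ pos σ z → level t ≤ level z
        IH {t} t≤z with t ≟ z
        ... | yes refl = ≤-refl
        ... | no  t≢z  = go k (ℕ.suc-injective (trans (sym up) ℓy)) (Fin.≤∧≢⇒< t≤z (t≢z ∘ pos-injective σ))
        below : level x ≤ suc (level z)
        below with pos σ z Fin.<? pos σ x
        ... | no  z≮x = ℕ.m≤n⇒m≤1+n (IH (≮⇒≥ z≮x))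
        ... | yes z<x with earlier x<y zy z<x
        ...   | u , ux , u≤z = ≤-trans (level-step ux) (s≤s (IH u≤z))

    level<⇒pos< : ∀ {x y} → level x < level y → pos σ x Fin.< pos σ y
    level<⇒pos< {x} {y} ℓx<ℓy with Fin.<-cmp (pos σ x) (pos σ y)
    ... | tri< x<y _ _ = x<y
    ... | tri≈ _ eq _  = contradiction ℓx<ℓy (<-irrefl (cong level (pos-injective σ eq)))
    ... | tri> _ _ y<x = contradiction (level-mono y<x) (<⇒≱ ℓx<ℓy)

    parent-exists : ∀ {w} → w ≢ r → ∃ (Parent G σ w)
    parent-exists {w} w≢r with level-pred w≢r
    ... | z , zw , up =
      maximiser (Fin.≤-totalOrder n) (λ u → adj? G w u ×-dec (pos σ u Fin.<? pos σ w)) (pos σ)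
        (z , adj-sym G zw , level<⇒pos< (≤-reflexive (sym up)))

    parent-level : Bipartite G → ∀ {w u} → Parent G σ w u → level w ≡ suc (level u)
    parent-level bip ((wu , u<w) , _) = level-adj bip (adj-sym G wu) (level-mono u<w)

-- Orderings from injective keys

-- A missed value `y` could be punched out, leaving an injection from `Fin (suc n)` into `Fin n`.
injective⇒surjective : ∀ {n} {f : Fin n → Fin n} → Injective _≡_ _≡_ f → ∀ y → ∃[ x ] f x ≡ y
injective⇒surjective {suc n} {f} inj y with any? (λ x → f x ≟ y)
... | yes found = found
... | no  none  = contradiction (λ {a} {b} → avoid-inj {a} {b}) (Fin.<⇒notInjective (ℕ.n<1+n n))
  where
  avoid : Fin (suc n) → Fin n
  avoid x = punchOut {i = y} {f x} λ y≡fx → none (x , sym y≡fx)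
  avoid-inj : Injective _≡_ _≡_ avoid
  avoid-inj eq = inj (Fin.punchOut-injective {i = y} _ _ eq)

module _ {n : ℕ} {P : Fin n → Set} (P? : Decidable P) where

  comprehension : Subset n
  comprehension = tabulate (does ∘ P?)

  ∈-comprehension⁺ : ∀ {x} → P x → x ∈ comprehension
  ∈-comprehension⁺ {x} px = lookup⇒[]= x _ (trans (lookup∘tabulate _ x) (dec-true (P? x) px))

  ∈-comprehension⁻ : ∀ {x} → x ∈ comprehension → P x
  ∈-comprehension⁻ {x} x∈ with P? x | trans (sym (lookup∘tabulate (does ∘ P?) x)) ([]=⇒lookup x∈)
  ... | yes px | _  = px
  ... | no  _  | ()

module _ {n : ℕ} (key : Fin n → ℕ) (key-injective : Injective _≡_ _≡_ key) where

  private
    below? : ∀ x → Decidable (λ y → key y < key x)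
    below? x y = key y ℕ.<? key x

    below : Fin n → Subset n
    below x = comprehension (below? x)

    x∉below : ∀ {x} → ¬ x ∈ below x
    x∉below x∈ = <-irrefl refl (∈-comprehension⁻ (below? _) x∈)

    ∣below∣<n : ∀ x → ∣ below x ∣ < n
    ∣below∣<n x = subst (∣ below x ∣ <_) (∣⊤∣≡n n) (p⊂q⇒∣p∣<∣q∣ ((λ _ → ∈⊤) , x , ∈⊤ , x∉below))

    rank : Fin n → Fin n
    rank x = fromℕ< (∣below∣<n x)

    rank-mono : ∀ {x y} → key x < key y → rank x Fin.< rank y
    rank-mono {x} {y} lt = subst₂ _<_ (sym (toℕ-fromℕ< (∣below∣<n x))) (sym (toℕ-fromℕ< (∣below∣<n y)))
      (p⊂q⇒∣p∣<∣q∣ ((λ z∈ → ∈-comprehension⁺ (below? y) (<-trans (∈-comprehension⁻ (below? x) z∈) lt)) ,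
                     x , ∈-comprehension⁺ (below? y) lt , x∉below))

    rank-reflects : ∀ {x y} → rank x Fin.< rank y → key x < key y
    rank-reflects {x} {y} lt with ℕ.<-cmp (key x) (key y)
    ... | tri< kx<ky _ _ = kx<ky
    ... | tri≈ _ eq _    = contradiction lt (<-irrefl (cong (toℕ ∘ rank) (key-injective eq)))
    ... | tri> _ _ ky<kx = contradiction (rank-mono ky<kx) (ℕ.<-asym lt)

    rank-injective : Injective _≡_ _≡_ rank
    rank-injective {x} {y} eq with ℕ.<-cmp (key x) (key y)
    ... | tri< kx<ky _ _ = contradiction (rank-mono kx<ky) (<-irrefl (cong toℕ eq))
    ... | tri≈ _ k≡k _   = key-injective k≡k
    ... | tri> _ _ ky<kx = contradiction (rank-mono ky<kx) (<-irrefl (cong toℕ (sym eq)))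

  abstract
    ordering-by-key : Σ[ σ ∈ Ordering n ] (∀ {x y} → pos σ x Fin.< pos σ y ⇔ key x < key y)
    ordering-by-key =
      -- The second argument becomes `pos`, so positions are ranks by definition.
      permutation (λ i → proj₁ (surj i)) rank
        (λ x → rank-injective (proj₂ (surj (rank x)))) (λ i → proj₂ (surj i)) ,
      mk⇔ rank-reflects rank-mono
      where
      surj : ∀ i → ∃[ x ] rank x ≡ i
      surj = injective⇒surjective rank-injective

-- The ordering that visits a geodesic from r to v first

module _ {V : Set} {E : V → V → Set} where

  head∈vertices : ∀ {a b} (p : Star E a b) → a ∈ₗ vertices p
  head∈vertices ε       = here refl
  head∈vertices (_ ◅ _) = here refl

  last∈vertices : ∀ {a b} (p : Star E a b) → b ∈ₗ vertices p
  last∈vertices ε       = here refl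
  last∈vertices (_ ◅ p) = there (last∈vertices p)

ascending-injective : ∀ {A : Set} {f : A → ℕ} {xs x y} → AllPairs (_<_ on f) xs →
                      x ∈ₗ xs → y ∈ₗ xs → f x ≡ f y → x ≡ y
ascending-injective (_ ∷ _)  (here refl) (here refl) _  = refl
ascending-injective (lt ∷ _) (here refl) (there y∈)  eq = contradiction (All.lookup lt y∈) (<-irrefl eq)
ascending-injective (lt ∷ _) (there x∈)  (here refl) eq = contradiction (All.lookup lt x∈) (<-irrefl (sym eq))
ascending-injective (_ ∷ as) (there x∈)  (there y∈)  eq = ascending-injective as x∈ y∈ eq

-- A digit `s` below `N` cannot make up for a smaller leading part: `b < a` would give
-- `s + N * b < N * suc b ≤ N * a`.
leading-digits-≤ : ∀ {N s t a b} → s < N → t + N * a ≤ s + N * b → a ≤ b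
leading-digits-≤ {N} {s} {t} {a} {b} s<N le = ≮⇒≥ λ b<a → <⇒≱ (begin-strict
  s + N * b  <⟨ ℕ.+-monoˡ-< (N * b) s<N ⟩
  N + N * b  ≡⟨ ℕ.*-suc N b ⟨
  N * suc b  ≤⟨ ℕ.*-monoʳ-≤ N b<a ⟩
  N * a      ≤⟨ ℕ.m≤n+m (N * a) t ⟩
  t + N * a  ∎) le
  where open ℕ.≤-Reasoning

module GeodesicFirst {n : ℕ} (G : Graph (Fin n)) (conn : Connected G) (r v : Fin n) where

  open Levels G conn r
  open Data.List.Membership.DecPropositional (_≟_ {n}) using () renaming (_∈?_ to _∈ₗ?_)

  private
    -- Digits range from 0 to `n`, because vertices off the spine get `suc (toℕ w)`.
    N : ℕ
    N = suc n

    spine : List (Fin n)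
    spine = vertices (Star.map {U = Adj G} proj₁ (geodesic v))

  -- Zero is the winning digit and is shared by the whole geodesic; its vertices are told apart by
  -- their levels, all others by their digits.
  tie : Fin n → ℕ
  tie w with w ∈ₗ? spine
  ... | yes _ = 0
  ... | no  _ = suc (toℕ w)

  private
    tie<N : ∀ w → tie w < N
    tie<N w with w ∈ₗ? spine
    ... | yes _ = s≤s z≤n
    ... | no  _ = s≤s (toℕ<n w)

    tie-spine : ∀ {w} → w ∈ₗ spine → tie w ≡ 0
    tie-spine {w} w∈ with w ∈ₗ? spine
    ... | yes _  = refl
    ... | no  w∉ = contradiction w∈ w∉

    tie-injective : ∀ {x y} → tie x ≡ tie y → x ≡ y ⊎ (x ∈ₗ spine × y ∈ₗ spine)
    tie-injective {x} {y} eq with x ∈ₗ? spine | y ∈ₗ? spine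
    ... | yes x∈ | yes y∈ = inj₂ (x∈ , y∈)
    ... | no  _  | no  _  = inj₁ (toℕ-injective (ℕ.suc-injective eq))

    -- Appends a tie-breaking digit to the base-N numeral of the parent; the successor keeps the
    -- leading digit nonzero, so that longer numerals are larger.
    append : Fin n → ℕ → ℕ
    append w m = tie w + N * suc m

    append-inc : ∀ {w m} → m < append w m
    append-inc {w} {m} = ≤-trans (ℕ.m≤n*m (suc m) N) (ℕ.m≤n+m (N * suc m) (tie w))

    append-mono : ∀ {w m m′} → m ≤ m′ → append w m ≤ append w m′
    append-mono {w} le = ℕ.+-monoʳ-≤ (tie w) (ℕ.*-monoʳ-≤ N (s≤s le))

  open Potential (potential G r append conn (λ {w} → append-inc {w}) (λ {w} → append-mono {w}))
    public renaming (cost to key; cost-root to key-root; cost-step to key-step; cost-pred to key-pred)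

  -- The numeral of length k whose tie-breaking digits all vanish.
  floor : ℕ → ℕ
  floor zero    = 0
  floor (suc k) = N * suc (floor k)

  private
    floor-mono : ∀ {k l} → k ≤ l → floor k ≤ floor l
    floor-mono z≤n      = z≤n
    floor-mono (s≤s le) = ℕ.*-monoʳ-≤ N (s≤s (floor-mono le))

    floor-injective : ∀ {k l} → floor k ≡ floor l → k ≡ l
    floor-injective {zero}  {zero}  _  = refl
    floor-injective {suc k} {suc l} eq =
      cong suc (floor-injective (ℕ.suc-injective (ℕ.*-cancelˡ-≡ _ _ N eq)))

  -- Induction on the key: the predecessor realising it has a smaller key and lies at most one level
  -- down, and the appended digit is at least zero.
  floor≤key : ∀ w → floor (level w) ≤ key w
  floor≤key w = <-rec (λ c → ∀ w → key w ≡ c → floor (level w) ≤ key w) bound (key w) w refl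
    where
    bound : ∀ c → (∀ {d} → d < c → ∀ w → key w ≡ d → floor (level w) ≤ key w) →
            ∀ w → key w ≡ c → floor (level w) ≤ key w
    bound c IH w refl with w ≟ r
    ... | yes refl = subst (λ k → floor k ≤ key r) (sym level-root) z≤n
    ... | no  w≢r with key-pred w≢r
    ...   | u , uw , eq = begin
      floor (level w)          ≤⟨ floor-mono (level-step uw) ⟩
      N * suc (floor (level u)) ≤⟨ ℕ.*-monoʳ-≤ N (s≤s (IH (≤-trans append-inc (≤-reflexive (sym eq))) u refl)) ⟩
      N * suc (key u)          ≤⟨ ℕ.m≤n+m _ (tie w) ⟩
      append w (key u)         ≡⟨ eq ⟨
      key w                    ∎
      where open ℕ.≤-Reasoning

  private
    -- Each edge offers an extension by the digit zero while the level rises by one, so the bound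
    -- passes along the walk.
    key≤floor : ∀ {a} (q : Star (Rise (Adj G) level) a v) →
                (∀ {x} → x ∈ₗ vertices (Star.map {U = Adj G} proj₁ q) → tie x ≡ 0) →
                key a ≤ floor (level a) →
                All (λ x → key x ≤ floor (level x)) (vertices (Star.map {U = Adj G} proj₁ q))
    key≤floor ε _ le = le ∷ []
    key≤floor {a} (_◅_ {j = b} (ab , up) q) tie≡0 le = le ∷ key≤floor q (tie≡0 ∘ there) (begin
      key b                      ≤⟨ key-step ab ⟩
      tie b + N * suc (key a)    ≡⟨ cong (_+ N * suc (key a)) (tie≡0 (there (head∈vertices (Star.map proj₁ q)))) ⟩
      N * suc (key a)            ≤⟨ ℕ.*-monoʳ-≤ N (s≤s le) ⟩
      floor (suc (level a))      ≡⟨ cong floor up ⟨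
      floor (level b)            ∎)
      where open ℕ.≤-Reasoning

    key-spine : ∀ {x} → x ∈ₗ spine → key x ≡ floor (level x)
    key-spine {x} x∈ = ≤-antisym
      (All.lookup (key≤floor (geodesic v) tie-spine (≤-trans (≤-reflexive key-root) z≤n)) x∈)
      (floor≤key x)

  -- `v` attains the lower bound `floor≤key` for its level, which places it before all other
  -- vertices there.
  key-v : key v ≡ floor (level v)
  key-v = key-spine (last∈vertices (Star.map proj₁ (geodesic v)))

  private
    key-pos : ∀ {w} → w ≢ r → 0 < key w
    key-pos {w} w≢r with key-pred w≢r
    ... | u , _ , eq = ≤-<-trans z≤n (<-≤-trans (append-inc {w}) (≤-reflexive (sym eq)))

  private
    key-tie : ∀ {x y a b} → key x ≡ append x a → key y ≡ append y b → key x ≡ key y → tie x ≡ tie y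
    key-tie {x} {y} {a} {b} kx ky eq =
      ℕ.+-cancelʳ-≡ (N * suc a) _ _ (trans appends (cong (λ m → tie y + N * m) (sym parents)))
      where
      appends : append x a ≡ append y b
      appends = trans (sym kx) (trans eq ky)
      parents : suc a ≡ suc b
      parents = ≤-antisym (leading-digits-≤ {t = tie x} {suc a} {suc b} (tie<N y) (≤-reflexive appends))
                          (leading-digits-≤ {t = tie y} {suc b} {suc a} (tie<N x) (≤-reflexive (sym appends)))

    -- Nonzero digits identify a vertex. Spine vertices have keys that determine the level, and a
    -- geodesic meets each level at most once.
    key-tie⇒≡ : ∀ {x y} → key x ≡ key y → tie x ≡ tie y → x ≡ y
    key-tie⇒≡ {x} {y} eq ties = [ id , (λ (x∈ , y∈) →
      ascending-injective (rising-ascending (geodesic v)) x∈ y∈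
        (floor-injective (trans (sym (key-spine x∈)) (trans eq (key-spine y∈))))) ] (tie-injective {x} {y} ties)

  key-injective : Injective _≡_ _≡_ key
  key-injective {x} {y} eq = cases (x ≟ r) (y ≟ r)
    where
    cases : Dec (x ≡ r) → Dec (y ≡ r) → x ≡ y
    cases (yes refl) (yes refl) = refl
    cases (yes refl) (no y≢r)   = contradiction (key-pos y≢r) (<-irrefl (trans (sym key-root) eq))
    cases (no x≢r)   (yes refl) = contradiction (key-pos x≢r) (<-irrefl (trans (sym key-root) (sym eq)))
    cases (no x≢r)   (no y≢r)   = let (_ , _ , kx) = key-pred x≢r ; (_ , _ , ky) = key-pred y≢r in
      key-tie⇒≡ eq (key-tie kx ky eq)

  σ : Ordering n
  σ = proj₁ (ordering-by-key key key-injective)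

  pos<⇔key< : ∀ {x y} → pos σ x Fin.< pos σ y ⇔ key x < key y
  pos<⇔key< = proj₂ (ordering-by-key key key-injective)

  root-first : ∀ x → pos σ r Fin.≤ pos σ x
  root-first x = ≮⇒≥ λ x<r → ℕ.n≮0 (subst (key x <_) key-root (to pos<⇔key< x<r))

  -- The predecessor `u` realising the key of `x` works: `append x (key u)` is at most
  -- `append y (key z)`, so comparing leading parts gives `key u ≤ key z`.
  earlier : EarlierHasEarlierNeighbour G σ
  earlier {x} {y} {z} x<y zy z<x with key-pred {x} (λ { refl → <⇒≱ z<x (root-first z) })
  ... | u , ux , kx = u , ux , ≮⇒≥ λ z<u → <⇒≱ (to pos<⇔key< z<u) (s≤s⁻¹
    (leading-digits-≤ {t = tie x} {a = suc (key u)} {suc (key z)} (tie<N y) (≤-trans (≤-reflexive (sym kx))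
      (≤-trans (<⇒≤ (to pos<⇔key< x<y)) (key-step zy)))))

-- The two implications

module _ {n : ℕ} (G : Graph (Fin n)) (conn : Connected G) (bip : Bipartite G) (v : Fin n) where

  -- A common `d` states that the distances agree and also that `w` can be reached in `G - v`.
  KeepsDistances : Fin n ∖ v → Set
  KeepsDistances r = ∀ (w : Fin n ∖ v) → ∃[ d ] (Dist G (proj₁ r) (proj₁ w) d × Dist (G - v) r w d)

  leaf⇒keepsDistances : (σ : Ordering n) → BFSOrdering G σ → LBranchLeaf G σ v →
                        ∀ {r} → (∀ x → pos σ r Fin.≤ pos σ x) → (r≢v : r ≢ v) → KeepsDistances (r , r≢v)
  leaf⇒keepsDistances σ bfs (_ , p , _ , only) {r} r-first r≢v w =
    level (proj₁ w) ,
    -- A single rising walk in `G - v`, also read in `G`, attains the level in both graphs.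
    rising-dist level-step level-root (Star.gmap proj₁ id (shortest w)) ,
    rising-dist {G = G - v} {ℓ = level ∘ proj₁} level-step level-root (shortest w)
    where
    open Levels G conn r
    early : EarlierHasEarlierNeighbour G σ
    early = bfs⇒earlier G σ bfs
    -- A child `w` and the parent `u` of `v` would both be its neighbours in the tree; a leaf has
    -- only one, yet `u` precedes `v` and `w` follows it.
    childless : ∀ {w} → ¬ Parent G σ w v
    childless {w} w→v with parent-exists G σ conn r-first early (r≢v ∘ sym)
    ... | u , v→u with trans (sym (only (inj₁ v→u))) (only (inj₂ w→v))
    ...   | refl = ℕ.<-asym (proj₂ (proj₁ v→u)) (proj₂ (proj₁ w→v))
    shortest : ∀ w → Star (Rise (Adj (G - v)) (level ∘ proj₁)) (r , r≢v) w
    shortest = descend (Adj (G - v)) proj₁ (r , r≢v) (λ { refl → refl }) λ (w , w≢v) → down {w} {w≢v}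
      where
      down : ∀ {w} {w≢v : w ≢ v} → w ≢ r → ∃[ u ] Rise (Adj (G - v)) (level ∘ proj₁) u (w , w≢v)
      down w≢r with parent-exists G σ conn r-first early w≢r
      ... | u , w→u = (u , λ { refl → childless w→u }) , adj-sym G (proj₁ (proj₁ w→u)) ,
                      parent-level G σ conn r-first early bip w→u

  keepsDistances⇒leaf : ∀ r → KeepsDistances r → Σ[ σ ∈ Ordering n ] (BFSOrdering G σ × LBranchLeaf G σ v)
  keepsDistances⇒leaf (r , r≢v) keeps =
    σ , earlier⇒bfs G σ earlier , not-first ,
    leaf (parent-exists G σ conn root-first earlier (r≢v ∘ sym))
    where
    open Levels G conn r
    open GeodesicFirst G conn r v

    not-first : ¬ IsFirst σ v
    not-first v-first = r≢v (pos-injective σ (Fin.≤-antisym (root-first v)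
                          (subst (_≤ toℕ (pos σ r)) (sym v-first) z≤n)))

    -- A shortest path to `w` in `G - v` has length `level w`, so its last edge rises from the
    -- previous level and starts away from `v`.
    other-pred : ∀ {w} → w ≢ v → w ≢ r → ∃[ u ] (u ≢ v × Adj G u w × level w ≡ suc (level u))
    other-pred {w} w≢v w≢r with keeps (w , w≢v)
    ... | d , dist , (p , len) , _
      with steep-walk-last {E = Adj (G - v)} {ℓ = level ∘ proj₁} level-step (Path.walk p)
             (≤-reflexive (trans (cong (_+ pathLength p) level-root)
               (trans len (dist-unique dist (rising-dist level-step level-root (geodesic w))))))
             (λ eq → w≢r (sym (cong proj₁ eq)))
    ... | (u , u≢v) , uw , up = u , u≢v , uw , up

    -- The neighbour `u` shares the level of `v`, where `v` has the least key; so `u` lies strictly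
    -- between `v` and `w`, and `v` is not rightmost.
    childless : ∀ {w} → ¬ Parent G σ w v
    childless {w} w→v@((wv , _) , rightmost) = refute (other-pred w≢v w≢r)
      where
      up : level w ≡ suc (level v)
      up = parent-level G σ conn root-first earlier bip w→v
      w≢v : w ≢ v
      w≢v refl = adj-irrefl G refl wv
      w≢r : w ≢ r
      w≢r refl = ℕ.1+n≢0 (trans (sym up) level-root)
      refute : ¬ (∃[ u ] (u ≢ v × Adj G u w × level w ≡ suc (level u)))
      refute (u , u≢v , uw , up′) = <⇒≱ (from pos<⇔key< kv<ku)
        (rightmost u (adj-sym G uw , level<⇒pos< G σ conn root-first earlier (≤-reflexive (sym up′))))
        where
        kv≤ku : key v ≤ key u
        kv≤ku = ≤-trans (≤-reflexive (trans key-v (cong floor (ℕ.suc-injective (trans (sym up) up′)))))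
                        (floor≤key u)
        kv<ku : key v < key u
        kv<ku = ℕ.≤∧≢⇒< kv≤ku (λ eq → u≢v (sym (key-injective eq)))

    leaf : ∃ (Parent G σ v) → Leaf (LTree G σ) v
    leaf (p , v→p) = p , inj₁ v→p , λ
      { (inj₁ v→y) → parent-unique G σ v→p v→y
      ; (inj₂ y→v) → contradiction y→v childless
      }

theorem7 : ∀ (n : ℕ) → 2 ≤ n →
    (G : Graph (Fin n)) → Connected G → Bipartite G → (v : Fin n) →
    (Σ[ σ ∈ Ordering n ] (BFSOrdering G σ × LBranchLeaf G σ v))
    ⇔
    (Σ[ r ∈ Fin n ∖ v ] (∀ (w : Fin n ∖ v) →
    ∃[ d ] (Dist G (proj₁ r) (proj₁ w) d × Dist (G - v) r w d)))
theorem7 (suc n) _ G conn bip v = mk⇔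
  (λ { (σ , bfs , v-leaf@(not-first , _)) →
       let r≢v = λ r≡v → not-first (cong toℕ (trans (cong (pos σ) (sym r≡v)) (inverseˡ σ)))
       in (σ ⟨$⟩ʳ Fin.zero , r≢v) ,
          leaf⇒keepsDistances G conn bip v σ bfs v-leaf
            (λ x → subst (Fin._≤ pos σ x) (sym (inverseˡ σ)) z≤n) r≢v })
  (λ { (r , keeps) → keepsDistances⇒leaf G conn bip v r keeps })
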